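{- There is a class $\mathcal C$ of finite graphs with the following properties: (i) $\mathcal C$ is closed under induced subgraphs and is first-order axiomatizable within finite graphs, i.e. there is a first-order sentence $\varphi$ in the vocabulary $\{E\}$ with $\mathcal C=\mathrm{Graph}_{\mathrm{fin}}(\varphi)$; (ii) $\mathcal C$ is not definable by a finite set of forbidden induced subgraphs, i.e. there is no finite set $\mathcal F$ of finite graphs with $\mathcal C=\mathrm{Forb}_{\mathrm{fin}}(\mathcal F)$.
   Context: Graphs are $\{E\}$-structures $G=(V(G),E(G))$ with $E$ binary, irreflexive and symmetric; $H$ is an induced subgraph of $G$ if $V(H)\subseteq V(G)$ and $E(H)=E(G)\cap (V(H)\times V(H))$. For a first-order sentence $\varphi$ of vocabulary $\{E\}$, $\mathrm{Graph}_{\mathrm{fin}}(\varphi)$ is the class of finite graphs that are models of $\varphi$. For a finite set $\mathcal F$ of finite graphs, $\mathrm{Forb}_{\mathrm{fin}}(\mathcal F)$ is the class of finite graphs having no induced subgraph isomorphic to a graph in $\mathcal F$. -}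

module Defs where

open import Data.Nat using (ℕ; suc)
open import Data.Fin using (Fin; zero; suc)
open import Data.Bool using (Bool; true; false)
open import Data.Product using (Σ; _×_; ∃)
open import Data.Sum using (_⊎_)
open import Data.Empty using (⊥)
open import Data.Unit using (⊤)
open import Data.List using (List)
open import Data.List.Relation.Unary.All using (All)
open import Relation.Nullary using (¬_)
open import Relation.Binary.PropositionalEquality using (_≡_)
open import Function.Definitions using (Injective)

record Graph : Set where
  field
    size  : ℕ
    adj   : Fin size → Fin size → Bool
    irrefl : ∀ i → adj i i ≡ false
    sym    : ∀ i j → adj i j ≡ adj j i
open Graph public

Edge : (G : Graph) → Fin (size G) → Fin (size G) → Set
Edge G i j = adj G i j ≡ true

record InducedEmbedding (H G : Graph) : Set where
  field
    map       : Fin (size H) → Fin (size G)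
    injective : Injective _≡_ _≡_ map
    preserves : ∀ i j → adj H i j ≡ adj G (map i) (map j)

data Formula (k : ℕ) : Set where
  ⊤'  : Formula k
  ⊥'  : Formula k
  _≐_ : Fin k → Fin k → Formula k
  E   : Fin k → Fin k → Formula k
  ¬'_ : Formula k → Formula k
  _∧'_ : Formula k → Formula k → Formula k
  _∨'_ : Formula k → Formula k → Formula k
  _⇒'_ : Formula k → Formula k → Formula k
  ∀'  : Formula (suc k) → Formula k
  ∃'  : Formula (suc k) → Formula k

Sentence : Set
Sentence = Formula 0

extend : {k n : ℕ} → (Fin k → Fin n) → Fin n → Fin (suc k) → Fin n
extend ρ a zero    = a
extend ρ a (suc i) = ρ i

Sat : (G : Graph) {k : ℕ} → (Fin k → Fin (size G)) → Formula k → Set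
Sat G ρ ⊤'       = ⊤
Sat G ρ ⊥'       = ⊥
Sat G ρ (x ≐ y)  = ρ x ≡ ρ y
Sat G ρ (E x y)  = Edge G (ρ x) (ρ y)
Sat G ρ (¬' φ)   = ¬ Sat G ρ φ
Sat G ρ (φ ∧' ψ) = Sat G ρ φ × Sat G ρ ψ
Sat G ρ (φ ∨' ψ) = Sat G ρ φ ⊎ Sat G ρ ψ
Sat G ρ (φ ⇒' ψ) = Sat G ρ φ → Sat G ρ ψ
Sat G ρ (∀' φ)   = ∀ a → Sat G (extend ρ a) φ
Sat G ρ (∃' φ)   = Σ (Fin (size G)) λ a → Sat G (extend ρ a) φ

_⊨_ : Graph → Sentence → Set
G ⊨ φ = Sat G (λ ()) φ

GraphClass : Set₁
GraphClass = Graph → Set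

GraphFin : Sentence → GraphClass
GraphFin φ G = G ⊨ φ

Forb : List Graph → GraphClass
Forb ℱ G = All (λ F → ¬ InducedEmbedding F G) ℱ

_≡ᶜ_ : GraphClass → GraphClass → Set
C ≡ᶜ D = ∀ G → (C G → D G) × (D G → C G)

ClosedUnderInducedSubgraphs : GraphClass → Set
ClosedUnderInducedSubgraphs C = ∀ H G → InducedEmbedding H G → C G → C H

{-# OPTIONS --safe #-}

-- A ladder interleaves points with cuts: adjacency between the two sorts is a half graph, so
-- it orders them linearly, and edges between cuts mark pairs with at most one point between
-- them. A frame is a 4-clique with three further vertices by which points, cuts, bottom and
-- top become definable. The class 𝒞 requires that every frame satisfies these universal
-- conditions (is tame), but is not full, where full means that the marked pairs lead from
-- the bottom to the top, past every point on the way. Fullness is not existential, yet in finite graphs it passes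
-- from H to a tame G ⊇ H, since the marked pairs of H leave no room for new points of G;
-- hence 𝒞 is hereditary. A full ladder with n points lies outside 𝒞, whereas its induced
-- subgraphs with fewer than n vertices lie in 𝒞: their only frames are, up to the rims and
-- the starting point, the original one, and a full one would contain all n points. So no
-- finite set of forbidden induced subgraphs can exclude all full ladders.
module Submission where

open import Defs
open import Data.Product using (Σ; _×_)
open import Data.List using (List)
open import Relation.Nullary using (¬_)

import Data.Bool as Bool
open import Data.Bool using (true)
open import Data.Empty using (⊥)
open import Data.Fin using (Fin; zero; suc; toℕ; fromℕ; inject₁)
open import Data.Fin.Induction using (spo-noetherian)
open import Data.Fin.Patterns
import Data.Fin.Properties as Fin
open import Data.Fin.Relation.Unary.Top using (view; ‵fromℕ; ‵inject₁)
import Data.List as List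
open import Data.List.Extrema.Nat using (max; xs≤max)
open import Data.List.Membership.Propositional using (_∈_)
open import Data.List.Membership.Propositional.Properties using (∈-map⁺)
import Data.List.Relation.Unary.All as All
import Data.Nat as ℕ
open import Data.Nat using (ℕ; zero; suc; _≤_; _<_; s≤s; z<s)
import Data.Nat.Properties as ℕ
open import Data.Product using (∃; _,_; proj₁; proj₂)
open import Data.Sum using (_⊎_; inj₁; inj₂; [_,_]′; swap)
open import Data.Sum.Function.Propositional using (_⊎-↔_)
open import Function using (_∘_; flip; id; _↔_; Inverse; mk⇔)
open import Function.Construct.Composition using (_↔-∘_)
open import Function.Construct.Identity using (↔-id)
open import Function.Definitions using (Injective)
open import Induction.WellFounded using (Acc; acc; WellFounded)
open import Relation.Binary.PropositionalEquality
  using (_≡_; _≢_; refl; trans; cong; cong₂; subst; resp₂; isEquivalence)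
  renaming (sym to ≡-sym)
open import Relation.Binary.Structures using (IsStrictPartialOrder)
open import Relation.Nullary using (Dec; yes; no; does; ¬?; contradiction)
open import Relation.Nullary.Decidable using (dec-true; dec-false; does-⇔; _⊎-dec_; _×-dec_)

-- Frames and the class `𝒞`

record Frame (V : Set) : Set where
  constructor frame
  field
    pole end rim₁ rim₂ bottom top start : V
open Frame

mapFrame : {V W : Set} → (V → W) → Frame V → Frame W
mapFrame f (frame p e r₁ r₂ b t s) = frame (f p) (f e) (f r₁) (f r₂) (f b) (f t) (f s)

-- A point x is thought of as lying below the cut c if c ∼ x, and above c otherwise.
module Ladder {V : Set} (_∼_ : V → V → Set) (F : Frame V) where

  -- The rims keep the clique of the frame out of both sorts. As `rim₁` is not adjacent to itself,
  -- points are tested against `rim₂` too; for cuts, adjacency to the pole already excludes `rim₁`.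
  Point : V → Set
  Point x = pole F ∼ x × ¬ rim₁ F ∼ x × ¬ rim₂ F ∼ x

  Cut : V → Set
  Cut c = ¬ pole F ∼ c × ¬ rim₁ F ∼ c

  -- On their own, `bottom` and `top` satisfy the same conditions; `start` lies between them and so
  -- orients the ladder. Its non-adjacency to `end` tells the pole from the end.
  IsFrame : Set
  IsFrame =
    (pole F ∼ end F × pole F ∼ rim₁ F × pole F ∼ rim₂ F ×
     end F ∼ rim₁ F × end F ∼ rim₂ F × rim₁ F ∼ rim₂ F) ×
    (Cut (bottom F) × end F ∼ bottom F) ×
    (Cut (top F) × end F ∼ top F) ×
    (Point (start F) × ¬ end F ∼ start F × ¬ bottom F ∼ start F × top F ∼ start F)

  Step : V → V → V → Set
  Step c x d = Cut c × Point x × Cut d × c ∼ d × ¬ c ∼ x × d ∼ x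

  -- `Nested` makes the sets of points below any two cuts comparable. `Full` replaces reachability
  -- of the top by a local, first-order condition: each point has a step past it that ends at the
  -- top or where another step begins.
  Separating Nested Bounded Tame Full : Set
  Separating = ∀ c x y d → Step c x d → Step c y d → x ≡ y
  Nested = ∀ c x d y → Cut c → Point x → Cut d → Point y →
           ¬ c ∼ x → d ∼ x → ¬ d ∼ y → ¬ c ∼ y
  Bounded = ∀ x → Point x → ¬ bottom F ∼ x × top F ∼ x
  Tame = Separating × Nested × Bounded
  Full =
    (∃ λ d → Step (bottom F) (start F) d) ×
    (∀ x → Point x → ∃ λ c → ∃ λ d → Step c x d ×
      (d ≡ top F ⊎ ∃ λ y → ∃ λ c′ → Step d y c′))

𝒞 : GraphClass
𝒞 G = ∀ F → let open Ladder (Edge G) F in IsFrame → Tame × ¬ Full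

-- First-order axiomatization

shift : {k : ℕ} → Frame (Fin k) → Frame (Fin (suc k))
shift = mapFrame suc

module Syntactic {k : ℕ} (F : Frame (Fin k)) where

  point : Fin k → Formula k
  point x = E (pole F) x ∧' ((¬' E (rim₁ F) x) ∧' (¬' E (rim₂ F) x))

  cut : Fin k → Formula k
  cut c = (¬' E (pole F) c) ∧' (¬' E (rim₁ F) c)

  isFrame : Formula k
  isFrame =
    (E (pole F) (end F) ∧' (E (pole F) (rim₁ F) ∧' (E (pole F) (rim₂ F) ∧'
     (E (end F) (rim₁ F) ∧' (E (end F) (rim₂ F) ∧' E (rim₁ F) (rim₂ F)))))) ∧'
    ((cut (bottom F) ∧' E (end F) (bottom F)) ∧'
    ((cut (top F) ∧' E (end F) (top F)) ∧'
    (point (start F) ∧' ((¬' E (end F) (start F)) ∧'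
      ((¬' E (bottom F) (start F)) ∧' E (top F) (start F))))))

  step : Fin k → Fin k → Fin k → Formula k
  step c x d = cut c ∧' (point x ∧' (cut d ∧' (E c d ∧' ((¬' E c x) ∧' E d x))))

module _ {k : ℕ} (F : Frame (Fin k)) where

  private
    F¹ = shift F
    F² = shift F¹
    F³ = shift F²
    F⁴ = shift F³
    F⁵ = shift F⁴
    module S¹ = Syntactic F¹
    module S³ = Syntactic F³
    module S⁴ = Syntactic F⁴
    module S⁵ = Syntactic F⁵

  separating nested bounded full : Formula k
  separating = ∀' (∀' (∀' (∀' (S⁴.step 3F 2F 0F ⇒' (S⁴.step 3F 1F 0F ⇒' (2F ≐ 1F))))))
  nested = ∀' (∀' (∀' (∀' (S⁴.cut 3F ⇒' (S⁴.point 2F ⇒' (S⁴.cut 1F ⇒' (S⁴.point 0F ⇒'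
    ((¬' E 3F 2F) ⇒' (E 1F 2F ⇒' ((¬' E 1F 0F) ⇒' (¬' E 3F 0F)))))))))))
  bounded = ∀' (S¹.point 0F ⇒' ((¬' E (bottom F¹) 0F) ∧' E (top F¹) 0F))
  full =
    ∃' (S¹.step (bottom F¹) (start F¹) 0F) ∧'
    ∀' (S¹.point 0F ⇒' ∃' (∃' (S³.step 1F 2F 0F ∧'
      ((0F ≐ top F³) ∨' ∃' (∃' (S⁵.step 2F 1F 0F))))))

φ : Sentence
φ = ∀' (∀' (∀' (∀' (∀' (∀' (∀'
  (Syntactic.isFrame F ⇒' ((separating F ∧' (nested F ∧' bounded F)) ∧' (¬' full F)))))))))
  where F = frame 6F 5F 4F 3F 2F 1F 0F

-- `Sat` of these formulas computes to the conditions of `Ladder`, so it remains to pack the seven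
-- quantified vertices into a frame.
𝒞-axiomatized : 𝒞 ≡ᶜ GraphFin φ
𝒞-axiomatized G =
  (λ c p e r₁ r₂ b t s → c (frame p e r₁ r₂ b t s)) ,
  (λ { sat (frame p e r₁ r₂ b t s) → sat p e r₁ r₂ b t s })

-- Transfer along embeddings

module Transfer {V W : Set} {_∼_ : V → V → Set} {_≈_ : W → W → Set}
  (f : V → W) (f-injective : Injective _≡_ _≡_ f)
  (f-preserves : ∀ {x y} → x ∼ y → f x ≈ f y) (f-reflects : ∀ {x y} → f x ≈ f y → x ∼ y)
  (F : Frame V) where

  private
    module L = Ladder _∼_ F
    module M = Ladder _≈_ (mapFrame f F)

  point⁺ : ∀ {x} → L.Point x → M.Point (f x)
  point⁺ (p , r₁ , r₂) = f-preserves p , r₁ ∘ f-reflects , r₂ ∘ f-reflects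

  point⁻ : ∀ {x} → M.Point (f x) → L.Point x
  point⁻ (p , r₁ , r₂) = f-reflects p , r₁ ∘ f-preserves , r₂ ∘ f-preserves

  cut⁺ : ∀ {c} → L.Cut c → M.Cut (f c)
  cut⁺ (p , r₁) = p ∘ f-reflects , r₁ ∘ f-reflects

  step⁺ : ∀ {c x d} → L.Step c x d → M.Step (f c) (f x) (f d)
  step⁺ (c , x , d , cd , cx , dx) =
    cut⁺ c , point⁺ x , cut⁺ d , f-preserves cd , cx ∘ f-reflects , f-preserves dx

  isFrame⁺ : L.IsFrame → M.IsFrame
  isFrame⁺ ((pe , pr₁ , pr₂ , er₁ , er₂ , rr) , (b , eb) , (t , et) , (s , es , bs , ts)) =
    (f-preserves pe , f-preserves pr₁ , f-preserves pr₂ ,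
     f-preserves er₁ , f-preserves er₂ , f-preserves rr) ,
    (cut⁺ b , f-preserves eb) , (cut⁺ t , f-preserves et) ,
    (point⁺ s , es ∘ f-reflects , bs ∘ f-reflects , f-preserves ts)

  tame⁻ : M.Tame → L.Tame
  tame⁻ (separating , nested , bounded) =
    (λ _ _ _ _ p q → f-injective (separating _ _ _ _ (step⁺ p) (step⁺ q))) ,
    (λ _ _ _ _ c x d y cx dx dy cy →
      nested _ _ _ _ (cut⁺ c) (point⁺ x) (cut⁺ d) (point⁺ y)
        (cx ∘ f-reflects) (f-preserves dx) (dy ∘ f-reflects) (f-preserves cy)) ,
    (λ _ x → let bx , tx = bounded _ (point⁺ x) in bx ∘ f-preserves , f-reflects tx)

  -- `Step` is quantifier-free and therefore passes upwards; surjectivity on points serves the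
  -- universal quantifier in `Full`.
  full⁺ : (∀ y → M.Point y → ∃ λ x → f x ≡ y) → L.Full → M.Full
  full⁺ points ((d , first) , onward) = (f d , step⁺ first) , onward⁺
    where
    onward⁺ : ∀ y → M.Point y → ∃ λ c → ∃ λ d → M.Step c y d ×
              (d ≡ f (top F) ⊎ ∃ λ z → ∃ λ c′ → M.Step d z c′)
    onward⁺ y py with points y py
    ... | x , refl with onward x (point⁻ py)
    ... | c , d , step , inj₁ refl = f c , f d , step⁺ step , inj₁ refl
    ... | c , d , step , inj₂ (z , c′ , step′) =
      f c , f d , step⁺ step , inj₂ (f z , f c′ , step⁺ step′)

-- The order of the points and heredity

module PointOrder {n : ℕ} (_∼_ : Fin n → Fin n → Set) (_∼?_ : ∀ x y → Dec (x ∼ y))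
  (F : Frame (Fin n)) (nested : Ladder.Nested _∼_ F) where

  open Ladder _∼_ F

  infix 4 _⊏_
  _⊏_ : Fin n → Fin n → Set
  x ⊏ y = Point x × Point y × ∃ λ c → Cut c × c ∼ x × ¬ c ∼ y

  -- The cut `d` between `y` and `z` also has `x` below it: otherwise nestedness, applied with `y`,
  -- would put `x` above `c`.
  ⊏-trans : ∀ {x y z} → x ⊏ y → y ⊏ z → x ⊏ z
  ⊏-trans {x} {y} (px , py , c , cutc , cx , cy) (_ , pz , d , cutd , dy , dz) with d ∼? x
  ... | yes dx = px , pz , d , cutd , dx , dz
  ... | no ¬dx = contradiction cx (nested _ _ _ _ cutc py cutd px cy dy ¬dx)

  ⊏-isStrictPartialOrder : IsStrictPartialOrder _≡_ _⊏_
  ⊏-isStrictPartialOrder = record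
    { isEquivalence = isEquivalence
    ; irrefl        = λ { refl (_ , _ , _ , _ , cx , ¬cx) → ¬cx cx }
    ; trans         = ⊏-trans
    ; <-resp-≈      = resp₂ _⊏_
    }

  -- Finiteness enters here: a climb towards ever larger points must stop.
  ⊐-wellFounded : WellFounded (flip _⊏_)
  ⊐-wellFounded = spo-noetherian ⊏-isStrictPartialOrder

module EmbeddingTransfer (H G : Graph) (ι : InducedEmbedding H G) =
  Transfer {_∼_ = Edge H} {_≈_ = Edge G} (InducedEmbedding.map ι) (InducedEmbedding.injective ι)
    (trans (≡-sym (InducedEmbedding.preserves ι _ _))) (trans (InducedEmbedding.preserves ι _ _))

module _ (H G : Graph) (ι : InducedEmbedding H G) (F : Frame (Fin (size H))) where

  private
    m = InducedEmbedding.map ι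
    module L = Ladder (Edge H) F
    module M = Ladder (Edge G) (mapFrame m F)
    module T = EmbeddingTransfer H G ι F

  -- The cuts of a full subladder H lie so densely that a point y of G, being above the
  -- bottom cut and below the top one, must lie between two consecutive cuts of H;
  -- separation then leaves only the point of H between these cuts.
  locate : L.Full → M.Tame → ∀ y → M.Point y → ∃ λ x → m x ≡ y
  locate ((_ , first) , onward) tame@(separating , nested , bounded) y py =
    climb (⊐-wellFounded _) first (proj₁ (bounded y py))
    where
    open PointOrder (Edge H) (λ _ _ → _ Bool.≟ _) F (proj₁ (proj₂ (T.tame⁻ tame)))

    between : ∀ {c x d} → L.Step c x d → ¬ Edge G (m c) y → Edge G (m d) y → m x ≡ y
    between step cy dy =
      let c , _ , d , cd , _ = T.step⁺ step in
      separating _ _ _ _ (T.step⁺ step) (c , py , d , cd , cy , dy)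

    climb : ∀ {c x d} → Acc (flip _⊏_) x → L.Step c x d → ¬ Edge G (m c) y → ∃ λ x → m x ≡ y
    climb {x = x} {d} (acc rec) step@(_ , px , cutd , _) cy
      with adj G (m d) y Bool.≟ true
    ... | yes dy = x , between step cy dy
    ... | no ¬dy with onward x px
    -- The step that `onward` gives around `x` may use other cuts than `c` and `d`, so its upper cut
    -- `d₁` has to be compared with `y` as well.
    ... | c₁ , d₁ , step₁@(_ , _ , cutd₁ , _ , _ , d₁x) , next
        with adj G (m d₁) y Bool.≟ true | next
    ... | yes d₁y | _ = x , between step₁ c₁y d₁y
      where
      c₁y = let _ , _ , _ , _ , _ , dx = T.step⁺ step
                c₁ , x , _ , _ , c₁x , _ = T.step⁺ step₁ in
            nested _ _ _ _ c₁ x (T.cut⁺ cutd) py c₁x dx ¬dy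
    ... | no ¬d₁y | inj₁ refl = contradiction (proj₂ (bounded y py)) ¬d₁y
    -- The cut `d₁` has `x` below it and the next point above it, so the climb continues from a
    -- larger point.
    ... | no ¬d₁y | inj₂ (_ , _ , step₂@(_ , px₂ , _ , _ , d₁x₂ , _)) =
      climb (rec (px , px₂ , d₁ , cutd₁ , d₁x , d₁x₂)) step₂ ¬d₁y

𝒞-hereditary : ClosedUnderInducedSubgraphs 𝒞
𝒞-hereditary H G ι c F isFrame =
  T.tame⁻ tame , λ full → ¬full (T.full⁺ (locate H G ι F full tame) full)
  where
  module T = EmbeddingTransfer H G ι F
  tame = proj₁ (c _ (T.isFrame⁺ isFrame))
  ¬full = proj₂ (c _ (T.isFrame⁺ isFrame))

-- The ladder and its adjacency

-- The full ladder is ct 0 < pt 0 < ct 1 < pt 1 < … < pt (n - 1) < ct n; the vertices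
-- hub 0F, …, hub 3F serve as the pole, the end and the two rims.
Vertex : ℕ → Set
Vertex n = Fin 4 ⊎ (Fin n ⊎ Fin (suc n))

pattern hub h = inj₁ h
pattern pt i = inj₂ (inj₁ i)
pattern ct j = inj₂ (inj₂ j)

module _ {n : ℕ} where

  Adj : Vertex n → Vertex n → Set
  Adj (hub h) (hub k) = h ≢ k
  Adj (hub h) (pt i)  = h ≡ 0F
  Adj (hub h) (ct j)  = h ≡ 1F × (toℕ j ≡ 0 ⊎ toℕ j ≡ n)
  Adj (pt i)  (hub h) = h ≡ 0F
  Adj (pt i)  (pt k)  = ⊥
  Adj (pt i)  (ct j)  = toℕ i < toℕ j
  Adj (ct j)  (hub h) = h ≡ 1F × (toℕ j ≡ 0 ⊎ toℕ j ≡ n)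
  Adj (ct j)  (pt i)  = toℕ i < toℕ j
  Adj (ct j)  (ct k)  = suc (toℕ j) ≡ toℕ k ⊎ suc (toℕ k) ≡ toℕ j

  Adj? : ∀ x y → Dec (Adj x y)
  Adj? (hub h) (hub k) = ¬? (h Fin.≟ k)
  Adj? (hub h) (pt i)  = h Fin.≟ 0F
  Adj? (hub h) (ct j)  = (h Fin.≟ 1F) ×-dec ((toℕ j ℕ.≟ 0) ⊎-dec (toℕ j ℕ.≟ n))
  Adj? (pt i)  (hub h) = h Fin.≟ 0F
  Adj? (pt i)  (pt k)  = no λ ()
  Adj? (pt i)  (ct j)  = toℕ i ℕ.<? toℕ j
  Adj? (ct j)  (hub h) = (h Fin.≟ 1F) ×-dec ((toℕ j ℕ.≟ 0) ⊎-dec (toℕ j ℕ.≟ n))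
  Adj? (ct j)  (pt i)  = toℕ i ℕ.<? toℕ j
  Adj? (ct j)  (ct k)  = (suc (toℕ j) ℕ.≟ toℕ k) ⊎-dec (suc (toℕ k) ℕ.≟ toℕ j)

  Adj-sym : ∀ x y → Adj x y → Adj y x
  Adj-sym (hub h) (hub k) h≢k = h≢k ∘ ≡-sym
  Adj-sym (hub h) (pt i)  p   = p
  Adj-sym (hub h) (ct j)  p   = p
  Adj-sym (pt i)  (hub h) p   = p
  Adj-sym (pt i)  (ct j)  p   = p
  Adj-sym (ct j)  (hub h) p   = p
  Adj-sym (ct j)  (pt i)  p   = p
  Adj-sym (ct j)  (ct k)  p   = swap p

  Adj-irrefl : ∀ x → ¬ Adj x x
  Adj-irrefl (hub h) h≢h = h≢h refl
  Adj-irrefl (ct j) (inj₁ p) = ℕ.1+n≢n p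
  Adj-irrefl (ct j) (inj₂ p) = ℕ.1+n≢n p

  -- Colouring and 4-cliques

  Hub Rim : Vertex n → Set
  Hub x = ∃ λ h → x ≡ hub h
  Rim x = x ≡ hub 2F ⊎ x ≡ hub 3F

  Rim? : ∀ x → Dec (Rim x)
  Rim? (hub 0F) = no λ { (inj₁ ()) ; (inj₂ ()) }
  Rim? (hub 1F) = no λ { (inj₁ ()) ; (inj₂ ()) }
  Rim? (hub 2F) = yes (inj₁ refl)
  Rim? (hub 3F) = yes (inj₂ refl)
  Rim? (inj₂ _) = no λ { (inj₁ ()) ; (inj₂ ()) }

  rim⇒hub : ∀ {x} → Rim x → Hub x
  rim⇒hub (inj₁ p) = _ , p
  rim⇒hub (inj₂ p) = _ , p

  rim-adj⇒hub : ∀ {x} y → Rim x → Adj x y → Hub y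
  rim-adj⇒hub (hub h) _ _ = h , refl
  rim-adj⇒hub (pt i) (inj₁ refl) ()
  rim-adj⇒hub (pt i) (inj₂ refl) ()
  rim-adj⇒hub (ct j) (inj₁ refl) ()
  rim-adj⇒hub (ct j) (inj₂ refl) ()

  alternate : ℕ → Fin 3
  alternate zero          = 1F
  alternate (suc zero)    = 2F
  alternate (suc (suc k)) = alternate k

  alternate-suc : ∀ k → alternate k ≢ alternate (suc k)
  alternate-suc (suc (suc k)) eq = alternate-suc k eq

  alternate-nonzero : ∀ k → 0F ≢ alternate k
  alternate-nonzero (suc (suc k)) eq = alternate-nonzero k eq

  -- The cuts induce a path, coloured alternately `1F` and `2F`. Points and the end share `0F`,
  -- being pairwise non-adjacent; the pole sees no cut and can reuse `1F`.
  colour : Vertex n → Fin 3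
  colour (hub 0F)            = 1F
  colour (hub (suc _))       = 0F
  colour (pt i)              = 0F
  colour (ct j)              = alternate (toℕ j)

  colour-proper : ∀ x y → ¬ Rim x → ¬ Rim y → Adj x y → colour x ≢ colour y
  colour-proper (hub 0F) (hub 0F) _ _ h≢h _ = h≢h refl
  colour-proper (hub 0F) (hub (suc _)) _ _ _ ()
  colour-proper (hub (suc _)) (hub 0F) _ _ _ ()
  colour-proper (hub 1F) (hub 1F) _ _ h≢h _ = h≢h refl
  colour-proper (hub 2F) _ ¬rim _ _ _ = ¬rim (inj₁ refl)
  colour-proper (hub 3F) _ ¬rim _ _ _ = ¬rim (inj₂ refl)
  colour-proper _ (hub 2F) _ ¬rim _ _ = ¬rim (inj₁ refl)
  colour-proper _ (hub 3F) _ ¬rim _ _ = ¬rim (inj₂ refl)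
  colour-proper (hub 0F) (pt i) _ _ _ ()
  colour-proper (pt i) (hub 0F) _ _ _ ()
  colour-proper (hub 1F) (ct j) _ _ _ eq = alternate-nonzero (toℕ j) eq
  colour-proper (ct j) (hub 1F) _ _ _ eq = alternate-nonzero (toℕ j) (≡-sym eq)
  colour-proper (pt i) (ct j) _ _ _ eq = alternate-nonzero (toℕ j) eq
  colour-proper (ct j) (pt i) _ _ _ eq = alternate-nonzero (toℕ j) (≡-sym eq)
  colour-proper (ct j) (ct k) _ _ (inj₁ p) eq =
    alternate-suc (toℕ j) (trans eq (cong alternate (≡-sym p)))
  colour-proper (ct j) (ct k) _ _ (inj₂ p) eq =
    alternate-suc (toℕ k) (trans (≡-sym eq) (cong alternate (≡-sym p)))

  -- Off the rims the ladder is 3-coloured, so a 4-clique meets a rim, and the neighbours of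
  -- a rim all lie in the hub.
  4-clique⇒hub : (x : Fin 4 → Vertex n) → (∀ i j → i ≢ j → Adj (x i) (x j)) → ∀ i → Hub (x i)
  4-clique⇒hub x clique i with Fin.any? (Rim? ∘ x)
  ... | no ¬rim with Fin.pigeonhole ℕ.≤-refl (colour ∘ x)
  ...   | j , k , j<k , eq = contradiction eq
    (colour-proper (x j) (x k) (¬rim ∘ (j ,_)) (¬rim ∘ (k ,_)) (clique j k (Fin.<⇒≢ j<k)))
  4-clique⇒hub x clique i | yes (k , rim) with k Fin.≟ i
  ... | yes refl = rim⇒hub rim
  ... | no k≢i   = rim-adj⇒hub (x i) rim (clique k i k≢i)

  -- Rigidity of frames in the ladder

  hub-nonadjacent : ∀ {x y} → Hub x → Hub y → ¬ Adj x y → x ≡ y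
  hub-nonadjacent (h , refl) (k , refl) ¬h≢k with h Fin.≟ k
  ... | yes refl = refl
  ... | no h≢k   = contradiction h≢k ¬h≢k

  -- If the pole and the end were exchanged, bottom and top would be points and start the
  -- first or last cut, which is adjacent to both or to neither of them.
  pole-rigid : ∀ {p e} b t s → Hub p → Hub e → Adj p e → ¬ Hub b → ¬ Hub t → ¬ Hub s →
    ¬ Adj p b → Adj e b → ¬ Adj p t → Adj e t → Adj p s → ¬ Adj e s → ¬ Adj b s → Adj t s →
    p ≡ hub 0F × b ≡ ct zero × t ≡ ct (fromℕ n)
  pole-rigid (hub _) _ _ _ _ _ ¬b _ _ _ _ _ _ _ _ _ _ = contradiction (_ , refl) ¬b
  pole-rigid _ (hub _) _ _ _ _ _ ¬t _ _ _ _ _ _ _ _ _ = contradiction (_ , refl) ¬t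
  pole-rigid _ _ (hub _) _ _ _ _ _ ¬s _ _ _ _ _ _ _ _ = contradiction (_ , refl) ¬s
  -- A hub vertex is adjacent to all points or to none, so neither `b` nor `t` can be a point
  -- together with `s`.
  pole-rigid (pt _) _ (pt _) (_ , refl) (_ , refl) _ _ _ _ ¬pb eb _ _ ps _ _ _ =
    contradiction ps ¬pb
  pole-rigid _ (pt _) (pt _) (_ , refl) (_ , refl) _ _ _ _ _ _ ¬pt _ ps _ _ _ =
    contradiction ps ¬pt
  pole-rigid (ct j) (ct k) (pt i) (_ , refl) (_ , refl) _ _ _ _ _ (_ , j-end) _ (_ , k-end)
    refl _ i≮j i<k =
    refl , cong (inj₂ ∘ inj₂) (Fin.toℕ-injective j≡0) ,
    cong (inj₂ ∘ inj₂) (Fin.toℕ-injective k≡n)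
    where
    j≡0 : toℕ j ≡ 0
    j≡0 = [ id , (λ j≡n → contradiction (subst (toℕ i <_) (≡-sym j≡n) (Fin.toℕ<n i)) i≮j) ]′ j-end
    k≡n : toℕ k ≡ toℕ (fromℕ n)
    k≡n = [ (λ k≡0 → contradiction (subst (toℕ i <_) k≡0 i<k) ℕ.n≮0)
          , (λ k≡n → trans k≡n (≡-sym (Fin.toℕ-fromℕ n))) ]′ k-end
  -- A cut `s` adjacent to `p` is the first or last one. If `b` or `t` is a cut too, then `e` is
  -- `hub 1F`, which is adjacent to `s`.
  pole-rigid (ct _) _ (ct _) (_ , refl) (_ , refl) _ _ _ _ _ (e≡1 , b-end) _ _ (_ , s-end) ¬es _ _ =
    contradiction (e≡1 , s-end) ¬es
  pole-rigid _ (ct _) (ct _) (_ , refl) (_ , refl) _ _ _ _ _ _ _ (e≡1 , _) (_ , s-end) ¬es _ _ =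
    contradiction (e≡1 , s-end) ¬es
  pole-rigid (pt i) (pt k) (ct j) (_ , refl) _ _ _ _ _ _ _ _ _ (_ , inj₁ j≡0) _ _ k<j =
    contradiction (subst (toℕ k <_) j≡0 k<j) ℕ.n≮0
  pole-rigid (pt i) (pt k) (ct j) (_ , refl) _ _ _ _ _ _ _ _ _ (_ , inj₂ j≡n) _ i≮j _ =
    contradiction (subst (toℕ i <_) (≡-sym j≡n) (Fin.toℕ<n i)) i≮j

  module _ (F : Frame (Vertex n)) (isFrame : Ladder.IsFrame Adj F) where

    open Ladder Adj F

    frame-hub : Hub (pole F) × Hub (end F) × Hub (rim₁ F) × Hub (rim₂ F)
    frame-hub = h 0F , h 1F , h 2F , h 3F
      where
      q : Fin 4 → Vertex n
      q 0F = pole F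
      q 1F = end F
      q 2F = rim₁ F
      q 3F = rim₂ F

      q-clique : ∀ i j → i ≢ j → Adj (q i) (q j)
      q-clique = let (pe , pr₁ , pr₂ , er₁ , er₂ , rr) , _ = isFrame in λ where
        0F 0F i≢i → contradiction refl i≢i
        0F 1F _ → pe
        0F 2F _ → pr₁
        0F 3F _ → pr₂
        1F 0F _ → Adj-sym _ _ pe
        1F 1F i≢i → contradiction refl i≢i
        1F 2F _ → er₁
        1F 3F _ → er₂
        2F 0F _ → Adj-sym _ _ pr₁
        2F 1F _ → Adj-sym _ _ er₁
        2F 2F i≢i → contradiction refl i≢i
        2F 3F _ → rr
        3F 0F _ → Adj-sym _ _ pr₂
        3F 1F _ → Adj-sym _ _ er₂
        3F 2F _ → Adj-sym _ _ rr
        3F 3F i≢i → contradiction refl i≢i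

      h = 4-clique⇒hub q q-clique

    -- A hub vertex non-adjacent to both rims would equal both, but the rims are adjacent. The same
    -- argument with the pole and `rim₁` handles cuts.
    point⇒¬hub : ∀ {x} → Point x → ¬ Hub x
    point⇒¬hub (_ , r₁x , r₂x) hub-x =
      let _ , _ , hub₁ , hub₂ = frame-hub
          (_ , _ , _ , _ , _ , rr) , _ = isFrame
      in Adj-irrefl _ (subst (Adj (rim₁ F))
           (trans (hub-nonadjacent hub₂ hub-x r₂x) (≡-sym (hub-nonadjacent hub₁ hub-x r₁x))) rr)

    cut⇒¬hub : ∀ {c} → Cut c → ¬ Hub c
    cut⇒¬hub (pc , r₁c) hub-c =
      let hub-p , _ , hub₁ , _ = frame-hub
          (_ , pr₁ , _) , _ = isFrame
      in Adj-irrefl _ (subst (Adj (pole F))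
           (trans (hub-nonadjacent hub₁ hub-c r₁c) (≡-sym (hub-nonadjacent hub-p hub-c pc))) pr₁)

    frame-rigid : pole F ≡ hub 0F × bottom F ≡ ct zero × top F ≡ ct (fromℕ n)
    frame-rigid =
      let (pe , _) , (cut-b@(¬pb , _) , eb) , (cut-t@(¬pt , _) , et) ,
            (point-s@(ps , _) , ¬es , ¬bs , ts) = isFrame
          hub-p , hub-e , _ = frame-hub
      in pole-rigid _ _ _ hub-p hub-e pe (cut⇒¬hub cut-b) (cut⇒¬hub cut-t) (point⇒¬hub point-s)
           ¬pb eb ¬pt et ps ¬es ¬bs ts

    point-form : ∀ {x} → Point x → ∃ λ i → x ≡ pt i
    point-form {hub _} px = contradiction (_ , refl) (point⇒¬hub px)
    point-form {pt i}  px = i , refl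
    point-form {ct j} (px , _) with subst (λ p → Adj p (ct j)) (proj₁ frame-rigid) px
    ... | () , _

    cut-form : ∀ {c} → Cut c → ∃ λ j → c ≡ ct j
    cut-form {hub _} cc = contradiction (_ , refl) (cut⇒¬hub cc)
    cut-form {pt i} (¬pc , _) =
      contradiction (subst (λ p → Adj p (pt i)) (≡-sym (proj₁ frame-rigid)) refl) ¬pc
    cut-form {ct j}  cc = j , refl

    -- Adjacent cuts have consecutive indices, and exactly one point lies between them; the
    -- descending case fails because a higher cut has more points below it.
    step-form : ∀ {c x d} → Step c x d → ∃ λ j → ∃ λ i → ∃ λ k →
                c ≡ ct j × x ≡ pt i × d ≡ ct k × toℕ j ≡ toℕ i × toℕ k ≡ suc (toℕ i)
    step-form (cut-c , point-x , cut-d , cd , ¬cx , dx)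
      with cut-form cut-c | point-form point-x | cut-form cut-d
    ... | j , refl | i , refl | k , refl with cd
    ... | inj₁ 1+j≡k =
      j , i , k , refl , refl , refl , j≡i , trans (≡-sym 1+j≡k) (cong suc j≡i)
      where
      j≡i : toℕ j ≡ toℕ i
      j≡i = ℕ.≤-antisym (ℕ.≮⇒≥ ¬cx) (ℕ.s≤s⁻¹ (subst (toℕ i <_) (≡-sym 1+j≡k) dx))
    ... | inj₂ 1+k≡j =
      contradiction (ℕ.<-trans dx (subst (toℕ k <_) 1+k≡j (ℕ.n<1+n _))) ¬cx

    tame : Tame
    tame = separating′ , nested′ , bounded′
      where
      separating′ : Separating
      separating′ _ _ _ _ step₁ step₂ with step-form step₁ | step-form step₂
      ... | _ , i , _ , refl , refl , _ , j≡i , _ | _ , k , _ , refl , refl , _ , j≡k , _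
        with refl ← Fin.toℕ-injective (trans (≡-sym j≡i) j≡k) = refl

      nested′ : Nested
      nested′ _ _ _ _ cut-c point-x cut-d point-y ¬cx dx ¬dy cy
        with cut-form cut-c | point-form point-x | cut-form cut-d | point-form point-y
      ... | _ , refl | _ , refl | _ , refl | _ , refl =
        ¬cx (ℕ.<-trans dx (ℕ.≤-<-trans (ℕ.≮⇒≥ ¬dy) cy))

      bounded′ : Bounded
      bounded′ x point-x with point-form point-x | frame-rigid
      ... | i , refl | _ , b≡ , t≡ =
        (λ bx → ℕ.n≮0 (subst (λ b → Adj b (pt i)) b≡ bx)) ,
        subst (λ t → Adj t (pt i)) (≡-sym t≡)
          (subst (toℕ i <_) (≡-sym (Fin.toℕ-fromℕ n)) (Fin.toℕ<n i))

-- Small induced subgraphs of the ladder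

pt-index : ∀ {n} {i k : Fin n} → _≡_ {A = Vertex n} (pt i) (pt k) → toℕ i ≡ toℕ k
pt-index refl = refl

ct-index : ∀ {n} {j k : Fin (suc n)} → _≡_ {A = Vertex n} (ct j) (ct k) → toℕ j ≡ toℕ k
ct-index refl = refl

module SmallLadder {m n : ℕ} (_∼_ : Fin m → Fin m → Set) (label : Fin m → Vertex n)
  (label-injective : Injective _≡_ _≡_ label)
  (label-preserves : ∀ {x y} → x ∼ y → Adj (label x) (label y))
  (label-reflects : ∀ {x y} → Adj (label x) (label y) → x ∼ y)
  (F : Frame (Fin m)) (isFrame : Ladder.IsFrame _∼_ F) where

  private
    F′ = mapFrame label F
    module L = Ladder _∼_ F
    module M = Ladder Adj F′
    module T = Transfer {_∼_ = _∼_} {_≈_ = Adj} label label-injective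
                 label-preserves label-reflects F

    isFrame′ : M.IsFrame
    isFrame′ = T.isFrame⁺ isFrame

  label-tame : L.Tame
  label-tame = T.tame⁻ (tame F′ isFrame′)

  -- Induction along the ladder: the first step leaves `ct 0` and so passes `pt 0`. A step past
  -- `pt k` ends at `ct (k + 1)`, which is not the top while `k + 1 < n`, so another step begins
  -- there and passes `pt (k + 1)`.
  reach : L.Full → ∀ k → k < n → ∃ λ x → L.Point x × ∃ λ i → label x ≡ pt i × toℕ i ≡ k
  reach ((d , first) , _) zero _
    with step-form F′ isFrame′ (T.step⁺ first) | frame-rigid F′ isFrame′
  ... | j , i , _ , b≡j , s≡i , _ , j≡i , _ | _ , b≡0 , _ =
    start F , proj₁ (proj₂ first) , i , s≡i ,
    trans (≡-sym j≡i) (ct-index (trans (≡-sym b≡j) b≡0))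
  reach full@(_ , onward) (suc k) 1+k<n with reach full k (ℕ.<-trans (ℕ.n<1+n k) 1+k<n)
  ... | x , px , i , x≡i , i≡k with onward x px
  ... | c , d , step , next with step-form F′ isFrame′ (T.step⁺ step)
  ... | _ , i′ , j , _ , x≡i′ , d≡j , _ , j≡1+i′ with next
  ... | inj₁ d≡top = contradiction (trans (≡-sym j≡1+k) j≡n) (ℕ.<⇒≢ 1+k<n)
    where
    j≡1+k : toℕ j ≡ suc k
    j≡1+k = trans j≡1+i′ (cong suc (trans (pt-index (trans (≡-sym x≡i′) x≡i)) i≡k))
    j≡n : toℕ j ≡ n
    j≡n = trans (ct-index (trans (≡-sym d≡j)
            (trans (cong label d≡top) (proj₂ (proj₂ (frame-rigid F′ isFrame′))))))
            (Fin.toℕ-fromℕ n)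
  ... | inj₂ (y , _ , step′) with step-form F′ isFrame′ (T.step⁺ step′)
  ... | j′ , l , _ , d≡j′ , y≡l , _ , j′≡l , _ = y , proj₁ (proj₂ step′) , l , y≡l ,
    trans (≡-sym j′≡l) (trans (ct-index (trans (≡-sym d≡j′) d≡j)) (trans j≡1+i′ (cong suc
      (trans (pt-index (trans (≡-sym x≡i′) x≡i)) i≡k))))

  label-full⇒n≤m : L.Full → n ≤ m
  label-full⇒n≤m full = Fin.injective⇒≤ {f = visit} visit-injective
    where
    visit : Fin n → Fin m
    visit i = proj₁ (reach full (toℕ i) (Fin.toℕ<n i))

    visit-injective : Injective _≡_ _≡_ visit
    visit-injective {i} {k} eq
      with reach full (toℕ i) (Fin.toℕ<n i) | reach full (toℕ k) (Fin.toℕ<n k)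
    ... | x , _ , i′ , x≡i′ , i′≡i | y , _ , k′ , y≡k′ , k′≡k =
      Fin.toℕ-injective (trans (≡-sym i′≡i)
        (trans (pt-index (trans (≡-sym x≡i′) (trans (cong label eq) y≡k′))) k′≡k))

-- The full frame of a ladder

module _ {n : ℕ} where

  stage : Frame (Vertex (suc n))
  stage = frame (hub 0F) (hub 1F) (hub 2F) (hub 3F) (ct zero) (ct (fromℕ (suc n))) (pt zero)

  open Ladder Adj stage

  pt-point : ∀ i → Point (pt i)
  pt-point _ = refl , (λ ()) , (λ ())

  ct-cut : ∀ j → Cut (ct j)
  ct-cut _ = (λ ()) , (λ ())

  stage-isFrame : IsFrame
  stage-isFrame =
    ((λ ()) , (λ ()) , (λ ()) , (λ ()) , (λ ()) , (λ ())) ,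
    (ct-cut zero , refl , inj₁ refl) ,
    (ct-cut (fromℕ (suc n)) , refl , inj₂ (Fin.toℕ-fromℕ (suc n))) ,
    (pt-point zero , (λ ()) , (λ ()) , z<s)

  pt-step : ∀ i → Step (ct (inject₁ i)) (pt i) (ct (suc i))
  pt-step i = ct-cut (inject₁ i) , pt-point i , ct-cut (suc i) ,
    inj₁ (cong suc (Fin.toℕ-inject₁ i)) ,
    (λ i<i → ℕ.<-irrefl (≡-sym (Fin.toℕ-inject₁ i)) i<i) , ℕ.n<1+n _

  top-or-step : ∀ j → ct j ≡ top stage ⊎ ∃ λ x → ∃ λ d → Step (ct j) x d
  top-or-step j with view j
  ... | ‵fromℕ     = inj₁ refl
  ... | ‵inject₁ i = inj₂ (pt i , ct (suc i) , pt-step i)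

  stage-full : Full
  stage-full = (ct 1F , pt-step zero) , onward
    where
    onward : ∀ x → Point x → ∃ λ c → ∃ λ d → Step c x d ×
             (d ≡ top stage ⊎ ∃ λ y → ∃ λ c′ → Step d y c′)
    onward x px with point-form stage stage-isFrame {x} px
    ... | i , refl = ct (inject₁ i) , ct (suc i) , pt-step i , top-or-step (suc i)

-- Ladders as finite graphs

ladderSize : ℕ → ℕ
ladderSize n = 4 ℕ.+ (n ℕ.+ suc n)

module _ (n : ℕ) where

  vertex↔ : Fin (ladderSize n) ↔ Vertex n
  vertex↔ = (↔-id (Fin 4) ⊎-↔ Fin.+↔⊎ {n} {suc n}) ↔-∘ Fin.+↔⊎ {4} {n ℕ.+ suc n}

  open Inverse vertex↔ public renaming (to to decode; from to encode)
    using (strictlyInverseˡ; strictlyInverseʳ)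

  ladder : Graph
  ladder = record
    { size   = ladderSize n
    ; adj    = λ i j → does (Adj? (decode i) (decode j))
    ; irrefl = λ i → dec-false (Adj? (decode i) (decode i)) (Adj-irrefl (decode i))
    ; sym    = λ i j → does-⇔
                        (mk⇔ (Adj-sym (decode i) (decode j)) (Adj-sym (decode j) (decode i)))
                        (Adj? (decode i) (decode j)) (Adj? (decode j) (decode i))
    }

  edge⇒adj : ∀ i j → Edge ladder i j → Adj (decode i) (decode j)
  edge⇒adj i j eq with Adj? (decode i) (decode j)
  ... | yes p = p
  edge⇒adj _ _ () | no _

  adj⇒edge : ∀ i j → Adj (decode i) (decode j) → Edge ladder i j
  adj⇒edge i j = dec-true (Adj? (decode i) (decode j))

  decode-injective : Injective _≡_ _≡_ decode
  decode-injective {i} {j} eq =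
    trans (≡-sym (strictlyInverseʳ i)) (trans (cong encode eq) (strictlyInverseʳ j))

  encode-injective : Injective _≡_ _≡_ encode
  encode-injective {x} {y} eq =
    trans (≡-sym (strictlyInverseˡ x)) (trans (cong decode eq) (strictlyInverseˡ y))

  encode-preserves : ∀ {x y} → Adj x y → Edge ladder (encode x) (encode y)
  encode-preserves {x} {y} = adj⇒edge (encode x) (encode y) ∘
    subst id (cong₂ Adj (≡-sym (strictlyInverseˡ x)) (≡-sym (strictlyInverseˡ y)))

  encode-reflects : ∀ {x y} → Edge ladder (encode x) (encode y) → Adj x y
  encode-reflects {x} {y} =
    subst id (cong₂ Adj (strictlyInverseˡ x) (strictlyInverseˡ y)) ∘ edge⇒adj (encode x) (encode y)

-- Failure of finite forbidden sets

small-sub-ladder : ∀ n H → InducedEmbedding H (ladder n) → size H < n → 𝒞 H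
small-sub-ladder n H ι small F isFrame =
  label-tame , λ full → ℕ.<⇒≱ small (label-full⇒n≤m full)
  where
  open InducedEmbedding ι
  open SmallLadder (Edge H) (decode n ∘ map) (injective ∘ decode-injective n)
    (λ {x} {y} → edge⇒adj n (map x) (map y) ∘ trans (≡-sym (preserves x y)))
    (λ {x} {y} → trans (preserves x y) ∘ adj⇒edge n (map x) (map y)) F isFrame

ladder∉𝒞 : ∀ n → ¬ 𝒞 (ladder (suc n))
ladder∉𝒞 n c =
  proj₂ (c (mapFrame (encode (suc n)) stage) (T.isFrame⁺ stage-isFrame)) (T.full⁺ onto stage-full)
  where
  module T = Transfer {_∼_ = Adj} {_≈_ = Edge (ladder (suc n))} (encode (suc n))
    (encode-injective (suc n)) (encode-preserves (suc n)) (encode-reflects (suc n)) stage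
  onto = λ y _ → decode (suc n) y , strictlyInverseʳ (suc n) y

self-embedding : ∀ G → InducedEmbedding G G
self-embedding G = record { map = id ; injective = id ; preserves = λ _ _ → refl }

-- The ladder has more points than any member of `ℱ` has vertices. A member embedding into it would
-- thus lie in `𝒞`, hence in `Forb ℱ`, although it embeds into itself. So the ladder avoids `ℱ`
-- without lying in `𝒞`.
𝒞≢Forb : ∀ ℱ → ¬ (𝒞 ≡ᶜ Forb ℱ)
𝒞≢Forb ℱ eq = ladder∉𝒞 bound (proj₂ (eq _) (All.tabulate no-embedding))
  where
  bound = max 0 (List.map size ℱ)

  no-embedding : ∀ {H} → H ∈ ℱ → ¬ InducedEmbedding H (ladder (suc bound))
  no-embedding {H} H∈ℱ ι = All.lookup (proj₁ (eq H) H∈𝒞) H∈ℱ (self-embedding H)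
    where
    H∈𝒞 = small-sub-ladder (suc bound) H ι
            (s≤s (All.lookup (xs≤max 0 (List.map size ℱ)) (∈-map⁺ size H∈ℱ)))

theorem1p1 : Σ GraphClass λ C →
    (ClosedUnderInducedSubgraphs C × Σ Sentence (λ φ → C ≡ᶜ GraphFin φ))
    × ¬ Σ (List Graph) (λ ℱ → C ≡ᶜ Forb ℱ)
theorem1p1 = 𝒞 , (𝒞-hereditary , φ , 𝒞-axiomatized) , λ (ℱ , eq) → 𝒞≢Forb ℱ eq
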